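{- Let $q$ be a prime with $q\equiv 3 \pmod 4$ and let $S=\{2,q\}$. Then there is no $S$-Diophantine quadruple.
   Context: For a finite set $S$ of primes, a positive integer is an $S$-unit if all its prime factors lie in $S$. An $m$-tuple $(a_1,\ldots,a_m)$ of positive, pairwise distinct integers is called an $S$-Diophantine $m$-tuple if $a_ia_j+1$ is an $S$-unit for all $i\neq j$. An $S$-Diophantine quadruple is the case $m=4$. -}

module Defs where

open import Data.Nat using (ℕ; _*_; _+_; _<_)
open import Data.Nat.Divisibility using (_∣_)
open import Data.Nat.Primality using (Prime)
open import Data.Product using (_×_)
open import Data.Sum using (_⊎_)
open import Relation.Binary.PropositionalEquality using (_≡_; _≢_)

IsSUnit2q : ℕ → ℕ → Set
IsSUnit2q q n = 0 < n × (∀ p → Prime p → p ∣ n → p ≡ 2 ⊎ p ≡ q)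

IsSDiophantineQuadruple2q : ℕ → ℕ → ℕ → ℕ → ℕ → Set
IsSDiophantineQuadruple2q q a b c d =
  (0 < a × 0 < b × 0 < c × 0 < d) ×
  (a ≢ b × a ≢ c × a ≢ d × b ≢ c × b ≢ d × c ≢ d) ×
  (IsSUnit2q q (a * b + 1) × IsSUnit2q q (a * c + 1) × IsSUnit2q q (a * d + 1) ×
   IsSUnit2q q (b * c + 1) × IsSUnit2q q (b * d + 1) × IsSUnit2q q (c * d + 1))

{-# OPTIONS --safe #-}

-- Label the edges of the complete graph on the quadruple by xy + 1.  If n divides the labels along
-- a path x, y, z, w, it divides xw + 1; so a triangle with all labels divisible by n gives
-- n ∣ x² + 1, which is impossible for n = 4 and n = q.  Hence the edges not divisible by 4, and
-- those not divisible by q, each meet every triangle.  The two sets are disjoint, so each contains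
-- a perfect matching, and after relabelling
--   xy + 1 = 2 q^β,  zw + 1 = 2 q^γ,  xz + 1 = 2^α,  yw + 1 = 2^δ.
-- Let w be the largest.  Comparing exponents, xw + 1 divides (x − y)(x − z), which forces x to be
-- the smallest.  Comparing the exponents of yz + 1 with α and β, either xz + 1 or xy + 1 divides
-- yz + 1, and size estimates (no-chain) exclude both.
module Submission where

open import Defs
open import Data.Empty using (⊥)
open import Data.List using ([]; _∷_)
open import Data.List.Relation.Unary.All using (All; []; _∷_)
open import Data.Nat
open import Data.Nat.Divisibility
open import Data.Nat.DivMod
open import Data.Nat.Induction using (<-rec)
open import Data.Nat.ListAction using (product)
open import Data.Nat.Primality using (Prime; prime[2]; euclidsLemma; prime⇒nonZero; irreducible[2])
open import Data.Nat.Primality.Factorisation using (factorise; module PrimeFactorisation)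
open import Data.Nat.Properties
open import Data.Nat.Tactic.RingSolver using (solve-∀)
open import Data.Product using (_×_; _,_; ∃; ∃₂)
open import Data.Sum using (_⊎_; inj₁; inj₂; [_,_]′)
open import Function using (flip)
open import Relation.Binary.PropositionalEquality
open import Relation.Nullary using (¬_; yes; no; contradiction)

-- Edge labels `x * y + 1` and their common divisors.

infix 8 _⊛_

_⊛_ : ℕ → ℕ → ℕ
x ⊛ y = x * y + 1

⊛-nonZero : ∀ x y → NonZero (x ⊛ y)
⊛-nonZero x y = >-nonZero (m≤n+m 1 (x * y))

⊛-comm : ∀ x y → x ⊛ y ≡ y ⊛ x
⊛-comm x y = cong (_+ 1) (*-comm x y)

∣⊛-comm : ∀ {n} x y → n ∣ x ⊛ y → n ∣ y ⊛ x
∣⊛-comm {n} x y = subst (n ∣_) (⊛-comm x y)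

-- Modulo `n` the products `x * y`, `y * z`, `z * w` are all `- 1`, and `x * w * (y * z)` equals
-- `x * y * (z * w)`, so `x * w` is `- 1` as well. Consequently, on a four-cycle of labels the least
-- exponent of a prime is attained at least twice; this is how exponents are compared later. With
-- `w` equal to `x` it turns a triangle into a divisor of `x * x + 1`.
∣⊛-cycle : ∀ {n} x y z w → n ∣ x ⊛ y → n ∣ y ⊛ z → n ∣ z ⊛ w → n ∣ x ⊛ w
∣⊛-cycle {n} x y z w n∣xy n∣yz n∣zw = ∣m+n∣m⇒∣n
  (subst (n ∣_) (sym (identity x y z w))
    (∣m∣n⇒∣m+n (∣n⇒∣m*n (x * w) n∣yz) (∣m∣n⇒∣m+n n∣xy n∣zw)))
  (∣m⇒∣m*n (z ⊛ w) n∣xy)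
  where
  identity : ∀ x y z w → (x * y + 1) * (z * w + 1) + (x * w + 1) ≡
                         x * w * (y * z + 1) + ((x * y + 1) + (z * w + 1))
  identity = solve-∀

-- `x` is invertible modulo `n`, with inverse `- y`, so it can be cancelled from `x * d`. The
-- identity cross-multiplies to avoid subtraction.
∣⊛⇒∣+ : ∀ {n} x y d → n ∣ x ⊛ y → n ∣ x ⊛ (y + d) → n ∣ d
∣⊛⇒∣+ {n} x y d n∣xy n∣xyd = ∣m+n∣m⇒∣n
  (subst (n ∣_) (sym (identity x y d)) (∣n⇒∣m*n (y + d) n∣xy))
  (∣n⇒∣m*n y n∣xyd)
  where
  identity : ∀ x y d → y * (x * (y + d) + 1) + d ≡ (y + d) * (x * y + 1)
  identity = solve-∀

∣⊛⇒∣∸ : ∀ {n} x {y z} → y ≤ z → n ∣ x ⊛ y → n ∣ x ⊛ z → n ∣ ∣ y - z ∣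
∣⊛⇒∣∸ {n} x {y} {z} y≤z n∣xy n∣xz = subst (n ∣_) (sym (m≤n⇒∣m-n∣≡n∸m y≤z))
  (∣⊛⇒∣+ x y (z ∸ y) n∣xy (subst (λ t → n ∣ x ⊛ t) (sym (m+[n∸m]≡n y≤z)) n∣xz))

∣⊛⇒∣∣-∣ : ∀ {n} x y z → n ∣ x ⊛ y → n ∣ x ⊛ z → n ∣ ∣ y - z ∣
∣⊛⇒∣∣-∣ {n} x y z n∣xy n∣xz with ≤-total y z
... | inj₁ y≤z = ∣⊛⇒∣∸ x y≤z n∣xy n∣xz
... | inj₂ z≤y = subst (n ∣_) (∣-∣-comm z y) (∣⊛⇒∣∸ x z≤y n∣xz n∣xy)

∣-∣≢0 : ∀ {m n} → m ≢ n → NonZero ∣ m - n ∣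
∣-∣≢0 m≢n = ≢-nonZero (λ eq → m≢n (∣m-n∣≡0⇒m≡n eq))

∣-∣≤ : ∀ {m n o} → m ≤ o → n ≤ o → ∣ m - n ∣ ≤ o
∣-∣≤ {m} {n} m≤o n≤o = ≤-trans (∣m-n∣≤m⊔n m n) (⊔-lub m≤o n≤o)

∤-⊛-< : ∀ {x y} z → x < y → 0 < z → ¬ z ⊛ y ∣ z ⊛ x
∤-⊛-< {x} {y} z x<y 0<z d = <⇒≱
  (+-monoˡ-< 1 (*-monoʳ-< z {{>-nonZero 0<z}} x<y))
  (∣⇒≤ {{⊛-nonZero z x}} d)

-- `x ⊛ w` is prime to `w`, so it would divide `∣ x - y ∣`, which is nonzero and at most `w`, hence
-- smaller than `x ⊛ w`.
∤-⊛-max : ∀ {x y w} → 0 < x → x ≢ y → x ≤ w → y ≤ w → ¬ x ⊛ w ∣ y ⊛ w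
∤-⊛-max {x} {y} {w} 0<x x≢y x≤w y≤w d = <⇒≱
  (≤-trans (s≤s (∣-∣≤ x≤w y≤w)) (≤-trans (s≤s (m≤n*m w x {{>-nonZero 0<x}})) (≤-reflexive (+-comm 1 (x * w)))))
  (∣⇒≤ {{∣-∣≢0 x≢y}} (∣⊛⇒∣∣-∣ w x y (∣⊛-comm x w ∣-refl) (∣⊛-comm y w d)))

-- Divisibility by prime powers.

^-monoʳ-∣ : ∀ p {i j} → i ≤ j → p ^ i ∣ p ^ j
^-monoʳ-∣ p {i} {j} i≤j = subst (p ^ i ∣_)
  (trans (sym (^-distribˡ-+-* p i (j ∸ i))) (cong (p ^_) (m+[n∸m]≡n i≤j))) (m∣m*n (p ^ (j ∸ i)))

prime∣^ : ∀ {p} → Prime p → ∀ n j → p ∣ n ^ j → p ∣ n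
prime∣^ pp n zero p∣1 = ∣-trans p∣1 (1∣ n)
prime∣^ pp n (suc j) p∣ = [ (λ p∣n → p∣n) , prime∣^ pp n j ]′ (euclidsLemma n (n ^ j) pp p∣)

^∣^*⇒≤ : ∀ p .{{_ : NonZero p}} {m} i j → ¬ p ∣ m → p ^ i ∣ p ^ j * m → i ≤ j
^∣^*⇒≤ p zero j p∤m d = z≤n
^∣^*⇒≤ p {m} (suc i) zero p∤m d = contradiction (subst (p ∣_) (*-identityˡ m) (m*n∣⇒m∣ p (p ^ i) d)) p∤m
^∣^*⇒≤ p {m} (suc i) (suc j) p∤m d = s≤s (^∣^*⇒≤ p i j p∤m
  (*-cancelˡ-∣ p (subst (p * p ^ i ∣_) (*-assoc p (p ^ j) m) d)))

-- Divisors of `a * a + 1`.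

even-or-odd : ∀ n → 2 ∣ n ⊎ 2 ∣ suc n
even-or-odd zero = inj₁ (2 ∣0)
even-or-odd (suc n) with even-or-odd n
... | inj₁ 2∣n = inj₂ (∣m∣n⇒∣m+n ∣-refl 2∣n)
... | inj₂ 2∣1+n = inj₁ 2∣1+n

odd⇒0< : ∀ {n} → 2 ∣ suc n → 0 < n
odd⇒0< {zero} 2∣1 = contradiction (∣1⇒≡1 2∣1) λ ()
odd⇒0< {suc _} _ = z<s

-- The left-hand side is 1 modulo 4, and 3 is its own inverse modulo 4.
cofactor≡3 : ∀ k m s → m % 4 ≡ 3 → s * 2 * (s * 2) + 1 ≡ k * m → k % 4 ≡ 3
cofactor≡3 k m s m≡3 eq = residue (k % 4) (m%n<n k 4) (begin
  k % 4 * 3 % 4        ≡⟨ cong (λ t → k % 4 * t % 4) m≡3 ⟨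
  k % 4 * (m % 4) % 4  ≡⟨ %-distribˡ-* k m 4 ⟨
  k * m % 4            ≡⟨ cong (_% 4) eq ⟨
  (s * 2 * (s * 2) + 1) % 4 ≡⟨ cong (_% 4) (rearrange s) ⟩
  (1 + s * s * 4) % 4  ≡⟨ [m+kn]%n≡m%n 1 (s * s) 4 ⟩
  1                    ∎)
  where
  open ≡-Reasoning
  rearrange : ∀ s → s * 2 * (s * 2) + 1 ≡ 1 + s * s * 4
  rearrange = solve-∀
  residue : ∀ r → r < 4 → r * 3 % 4 ≡ 1 → r ≡ 3
  residue 0 _ ()
  residue 1 _ ()
  residue 2 _ ()
  residue 3 _ _ = refl
  residue (suc (suc (suc (suc _)))) (s≤s (s≤s (s≤s (s≤s ())))) _

∣-square-mod : ∀ m a .{{_ : NonZero m}} → m ∣ a * a + 1 → m ∣ a % m * (a % m) + 1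
∣-square-mod m a d = ∣m+n∣m⇒∣n
  (subst (m ∣_) (trans (cong (λ t → t * t + 1) (m≡m%n+[m/n]*n a m)) (identity (a % m) (a / m) m)) d)
  (m∣m*n _)
  where
  identity : ∀ r c m → (r + c * m) * (r + c * m) + 1 ≡ m * (c * (r + r + c * m)) + (r * r + 1)
  identity = solve-∀

-- Modulo `r + r′`, `r′` is `- r` and has the same square. For an odd modulus this trades an odd
-- root for an even one.
∣-square-complement : ∀ r r′ → r + r′ ∣ r * r + 1 → r + r′ ∣ r′ * r′ + 1
∣-square-complement r r′ d = ∣m+n∣m⇒∣n
  (subst (r + r′ ∣_) (identity r r′) (∣m∣n⇒∣m+n d (m∣m*n r′)))
  (m∣m*n r)
  where
  identity : ∀ r r′ → r * r + 1 + (r + r′) * r′ ≡ (r + r′) * r + (r′ * r′ + 1)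
  identity = solve-∀

%4≡3⇒2∤ : ∀ {m} → m % 4 ≡ 3 → ¬ 2 ∣ m
%4≡3⇒2∤ {m} m≡3 2∣m with ∣m+n∣m⇒∣n {2} {m / 4 * 4} {3}
  (subst (2 ∣_) (trans (m≡m%n+[m/n]*n m 4) (trans (cong (_+ m / 4 * 4) m≡3) (+-comm 3 (m / 4 * 4)))) 2∣m)
  (∣n⇒∣m*n (m / 4) (divides 2 refl))
... | divides (suc (suc _)) ()

-- Infinite descent: reduced modulo m to an even root a < m, the cofactor of m in a² + 1 is again
-- 3 modulo 4, and smaller than m.
%4≡3⇒∤square+1 : ∀ m → m % 4 ≡ 3 → ∀ a → ¬ m ∣ a * a + 1
%4≡3⇒∤square+1 = <-rec _ step
  where
  step : ∀ m → (∀ {k} → k < m → k % 4 ≡ 3 → ∀ a → ¬ k ∣ a * a + 1) →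
         m % 4 ≡ 3 → ∀ a → ¬ m ∣ a * a + 1
  step m@(suc (suc m′)) rec m≡3 a m∣ = reduce (even-or-odd r)
    where
    r = a % m

    even-root : ∀ s → s * 2 < m → ¬ m ∣ s * 2 * (s * 2) + 1
    even-root s (s≤s s<m) (divides k eq) =
      rec (*-cancelʳ-< m k m k*m<m*m) (cofactor≡3 k m s m≡3 eq) (s * 2)
          (divides m (trans eq (*-comm k m)))
      where
      k*m<m*m : k * m < m * m
      k*m<m*m = begin-strict
        k * m                     ≡⟨ eq ⟨
        s * 2 * (s * 2) + 1       ≤⟨ +-monoˡ-≤ 1 (*-mono-≤ s<m s<m) ⟩
        suc m′ * suc m′ + 1       <⟨ m<m+n _ {suc m′ + suc m′} z<s ⟩
        suc m′ * suc m′ + 1 + (suc m′ + suc m′)  ≡⟨ identity (suc m′) ⟩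
        m * m                     ∎
        where
        open ≤-Reasoning
        identity : ∀ n → n * n + 1 + (n + n) ≡ (1 + n) * (1 + n)
        identity = solve-∀

    reduce : 2 ∣ r ⊎ 2 ∣ suc r → ⊥
    reduce (inj₁ (divides s r≡)) = even-root s (subst (_< m) r≡ (m%n<n a m))
      (subst (λ t → m ∣ t * t + 1) r≡ (∣-square-mod m a m∣))
    reduce (inj₂ 2∣1+r) with even-or-odd m
    ... | inj₁ 2∣m = %4≡3⇒2∤ m≡3 2∣m
    ... | inj₂ 2∣1+m = complement (∣m+n∣m⇒∣n (subst (2 ∣_) (cong suc (sym r+r′≡m)) 2∣1+m) 2∣1+r)
      where
      r′ = m ∸ r
      r+r′≡m : r + r′ ≡ m
      r+r′≡m = m+[n∸m]≡n (m%n≤n a m)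
      m∣r′ : m ∣ r′ * r′ + 1
      m∣r′ = subst (_∣ r′ * r′ + 1) r+r′≡m
        (∣-square-complement r r′ (subst (_∣ r * r + 1) (sym r+r′≡m) (∣-square-mod m a m∣)))
      complement : ¬ 2 ∣ r′
      complement (divides s r′≡) = even-root s
        (subst (_< m) r′≡ (subst (r′ <_) r+r′≡m (m<n+m r′ (odd⇒0< 2∣1+r))))
        (subst (λ t → m ∣ t * t + 1) r′≡ m∣r′)

%4≡3⇒no-∣-triangle : ∀ {m} → m % 4 ≡ 3 → ∀ a b c → m ∣ a ⊛ b → m ∣ a ⊛ c → ¬ m ∣ b ⊛ c
%4≡3⇒no-∣-triangle {m} m≡3 a b c m∣ab m∣ac m∣bc =
  %4≡3⇒∤square+1 m m≡3 a (∣⊛-cycle a b c a m∣ab m∣bc (∣⊛-comm a c m∣ac))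

4∤square+1 : ∀ a → ¬ 4 ∣ a * a + 1
4∤square+1 a d with a % 4 | m%n<n a 4 | ∣-square-mod 4 a d
... | 0 | _ | d′ = >⇒∤ (s≤s (s≤s z≤n)) d′
... | 1 | _ | d′ = >⇒∤ (s≤s (s≤s (s≤s z≤n))) d′
... | 2 | _ | divides (suc (suc _)) ()
... | 3 | _ | divides (suc (suc (suc _))) ()
... | suc (suc (suc (suc _))) | s≤s (s≤s (s≤s (s≤s ()))) | _

no-4∣-triangle : ∀ a b c → 4 ∣ a ⊛ b → 4 ∣ a ⊛ c → ¬ 4 ∣ b ⊛ c
no-4∣-triangle a b c d e f = 4∤square+1 a (∣⊛-cycle a b c a d f (∣⊛-comm a c e))

-- The size estimate for chains of labels.

∣∣-∣⇒≡+ : ∀ {n x y} → x < y → n ∣ ∣ x - y ∣ → ∃ λ k → y ≡ x + suc k * n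
∣∣-∣⇒≡+ {n} {x} {y} x<y (divides zero eq) = contradiction (∣m-n∣≡0⇒m≡n eq) (<⇒≢ x<y)
∣∣-∣⇒≡+ {n} {x} {y} x<y (divides (suc k) eq) = k , (begin
  y            ≡⟨ m+[n∸m]≡n (<⇒≤ x<y) ⟨
  x + (y ∸ x)  ≡⟨ cong (x +_) (trans (sym (m≤n⇒∣m-n∣≡n∸m (<⇒≤ x<y))) eq) ⟩
  x + suc k * n ∎)
  where open ≡-Reasoning

-- Reads off the cofactor of `x ⊛ p` in `p ⊛ o` once `o` is known to be `x` plus a multiple of
-- `x ⊛ p`.
⊛-factor-+ : ∀ x p t → p ⊛ (x + t * x ⊛ p) ≡ x ⊛ p * (1 + p * t)
⊛-factor-+ = identity
  where
  identity : ∀ x p t → p * (x + t * (x * p + 1)) + 1 ≡ (x * p + 1) * (1 + p * t)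
  identity = solve-∀

-- With N = xp + 1, write w = p + KNu and o = x + TN; then Q = 1 + xKu and Qu = 1 + pT.  Modulo Q
-- the latter gives Q ∣ 1 + xT, hence u ≤ T, whereas Q ≤ p gives T < u.
no-chain : ∀ {x p o w Q u} → 0 < x → x < p → p < w → x < o →
           x ⊛ w ≡ x ⊛ p * Q → p ⊛ o ≡ x ⊛ p * (Q * u) →
           Q ∣ ∣ x - p ∣ → x ⊛ p * u ∣ ∣ p - w ∣ → ⊥
no-chain {x} {p} {o} {w} {Q} {u} 0<x x<p p<w x<o xw≡ po≡ Q∣ Nu∣
  with ∣∣-∣⇒≡+ x<p Q∣ | ∣∣-∣⇒≡+ p<w Nu∣
     | ∣∣-∣⇒≡+ x<o (∣⊛⇒∣∣-∣ p x o (∣⊛-comm x p ∣-refl) (subst (x ⊛ p ∣_) (sym po≡) (m∣m*n (Q * u))))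
... | m , p≡ | k , w≡ | t , o≡ = <⇒≱ t<u u≤t
  where
  N = x ⊛ p
  T = suc t
  instance
    _ : NonZero N
    _ = ⊛-nonZero x p
    _ : NonZero x
    _ = >-nonZero 0<x
    _ : NonZero p
    _ = >-nonZero (<-trans 0<x x<p)

  Q≡ : Q ≡ 1 + x * (suc k * u)
  Q≡ = *-cancelˡ-≡ Q _ N (begin
    N * Q                     ≡⟨ xw≡ ⟨
    x ⊛ w                     ≡⟨ cong (x ⊛_) w≡ ⟩
    x ⊛ (p + suc k * (N * u)) ≡⟨ cong (x ⊛_) (cong (p +_) (rearrange (suc k) N u)) ⟩
    x ⊛ (p + suc k * u * N)   ≡⟨ cong (λ v → x ⊛ (p + suc k * u * v)) (⊛-comm x p) ⟩
    x ⊛ (p + suc k * u * p ⊛ x) ≡⟨ ⊛-factor-+ p x (suc k * u) ⟩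
    p ⊛ x * (1 + x * (suc k * u)) ≡⟨ cong (_* (1 + x * (suc k * u))) (⊛-comm p x) ⟩
    N * (1 + x * (suc k * u)) ∎)
    where
    open ≡-Reasoning
    rearrange : ∀ a b c → a * (b * c) ≡ a * c * b
    rearrange = solve-∀

  Qu≡ : Q * u ≡ 1 + p * T
  Qu≡ = *-cancelˡ-≡ (Q * u) _ N
    (trans (sym po≡) (trans (cong (p ⊛_) o≡) (⊛-factor-+ x p T)))

  Q∣1+xT : Q ∣ 1 + x * T
  Q∣1+xT = ∣m+n∣m⇒∣n (subst (Q ∣_) Qu≡′ (m∣m*n u)) (n∣m*n (T * suc m))
    where
    identity : ∀ x M Q T → 1 + (x + M * Q) * T ≡ T * M * Q + (1 + x * T)
    identity = solve-∀
    Qu≡′ : Q * u ≡ T * suc m * Q + (1 + x * T)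
    Qu≡′ = trans Qu≡ (trans (cong (λ v → 1 + v * T) p≡) (identity x (suc m) Q T))

  u≤t : u ≤ T
  u≤t = ≤-trans (m≤n*m u (suc k))
    (*-cancelˡ-≤ x (s≤s⁻¹ (subst (_≤ 1 + x * T) Q≡ (∣⇒≤ Q∣1+xT))))

  Q≤p : Q ≤ p
  Q≤p = subst (Q ≤_) (sym p≡) (≤-trans (m≤n*m Q (suc m)) (m≤n+m (suc m * Q) x))

  t<u : T < u
  t<u = *-cancelˡ-< p T u (≤-trans (≤-reflexive (sym Qu≡)) (*-monoˡ-≤ u Q≤p))

-- Parity of labels, and matchings in the complete graph on four vertices.

⊛-odd : ∀ x y → 2 ∣ x ⊛ y → 2 ∣ suc x
⊛-odd x y d with even-or-odd x
... | inj₁ 2∣x = contradiction (∣1⇒≡1 (∣m+n∣m⇒∣n d (∣m⇒∣m*n y 2∣x))) λ ()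
... | inj₂ 2∣1+x = 2∣1+x

2∣⊛ : ∀ x y → 2 ∣ suc x → 2 ∣ suc y → 2 ∣ x ⊛ y
2∣⊛ x y d e = ∣m+n∣m⇒∣n
  (subst (2 ∣_) (identity x y) (∣m∣n⇒∣m+n (∣m⇒∣m*n (suc y) d) (∣-refl {2})))
  (∣m∣n⇒∣m+n d e)
  where
  identity : ∀ x y → (1 + x) * (1 + y) + 2 ≡ ((1 + x) + (1 + y)) + (x * y + 1)
  identity = solve-∀

-- The types say which edges belong to a set that meets every triangle and contains none. If it
-- missed an edge of each perfect matching, the three missed edges would form a triangle, which is
-- then not met, or a star. In the star case each triangle through the centre forces its third edge
-- into the set, and these three edges form a triangle.
hitting⇒matching : ∀ {ab ac ad bc bd cd : Set} →
  ab ⊎ ac ⊎ bc → ab ⊎ ad ⊎ bd → ac ⊎ ad ⊎ cd → bc ⊎ bd ⊎ cd →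
  ¬ (ab × ac × bc) → ¬ (ab × ad × bd) → ¬ (ac × ad × cd) → ¬ (bc × bd × cd) →
  (ab × cd) ⊎ (ac × bd) ⊎ (ad × bc)
hitting⇒matching (inj₁ ab) _ (inj₂ (inj₂ cd)) _ _ _ _ _ = inj₁ (ab , cd)
hitting⇒matching (inj₁ ab) _ _ (inj₂ (inj₂ cd)) _ _ _ _ = inj₁ (ab , cd)
hitting⇒matching (inj₁ ab) _ (inj₁ ac) (inj₁ bc) ¬abc _ _ _ = contradiction (ab , ac , bc) ¬abc
hitting⇒matching (inj₁ ab) _ (inj₁ ac) (inj₂ (inj₁ bd)) _ _ _ _ = inj₂ (inj₁ (ac , bd))
hitting⇒matching (inj₁ ab) _ (inj₂ (inj₁ ad)) (inj₁ bc) _ _ _ _ = inj₂ (inj₂ (ad , bc))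
hitting⇒matching (inj₁ ab) _ (inj₂ (inj₁ ad)) (inj₂ (inj₁ bd)) _ ¬abd _ _ = contradiction (ab , ad , bd) ¬abd
hitting⇒matching (inj₂ (inj₁ ac)) (inj₂ (inj₂ bd)) _ _ _ _ _ _ = inj₂ (inj₁ (ac , bd))
hitting⇒matching (inj₂ (inj₁ ac)) _ _ (inj₂ (inj₁ bd)) _ _ _ _ = inj₂ (inj₁ (ac , bd))
hitting⇒matching (inj₂ (inj₁ ac)) (inj₁ ab) _ (inj₁ bc) ¬abc _ _ _ = contradiction (ab , ac , bc) ¬abc
hitting⇒matching (inj₂ (inj₁ ac)) (inj₁ ab) _ (inj₂ (inj₂ cd)) _ _ _ _ = inj₁ (ab , cd)
hitting⇒matching (inj₂ (inj₁ ac)) (inj₂ (inj₁ ad)) _ (inj₁ bc) _ _ _ _ = inj₂ (inj₂ (ad , bc))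
hitting⇒matching (inj₂ (inj₁ ac)) (inj₂ (inj₁ ad)) _ (inj₂ (inj₂ cd)) _ _ ¬acd _ = contradiction (ac , ad , cd) ¬acd
hitting⇒matching (inj₂ (inj₂ bc)) (inj₂ (inj₁ ad)) _ _ _ _ _ _ = inj₂ (inj₂ (ad , bc))
hitting⇒matching (inj₂ (inj₂ bc)) _ (inj₂ (inj₁ ad)) _ _ _ _ _ = inj₂ (inj₂ (ad , bc))
hitting⇒matching (inj₂ (inj₂ bc)) (inj₁ ab) (inj₁ ac) _ ¬abc _ _ _ = contradiction (ab , ac , bc) ¬abc
hitting⇒matching (inj₂ (inj₂ bc)) (inj₁ ab) (inj₂ (inj₂ cd)) _ _ _ _ _ = inj₁ (ab , cd)
hitting⇒matching (inj₂ (inj₂ bc)) (inj₂ (inj₂ bd)) (inj₁ ac) _ _ _ _ _ = inj₂ (inj₁ (ac , bd))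
hitting⇒matching (inj₂ (inj₂ bc)) (inj₂ (inj₂ bd)) (inj₂ (inj₂ cd)) _ _ _ _ ¬bcd = contradiction (bc , bd , cd) ¬bcd

one-missing : ∀ n r s t → (n ∣ r → n ∣ s → ¬ n ∣ t) → ¬ n ∣ r ⊎ ¬ n ∣ s ⊎ ¬ n ∣ t
one-missing n r s t no-all with n ∣? r | n ∣? s
... | no n∤r | _ = inj₁ n∤r
... | yes _ | no n∤s = inj₂ (inj₁ n∤s)
... | yes n∣r | yes n∣s = inj₂ (inj₂ (no-all n∣r n∣s))

-- S-units as products of powers of 2 and `q`.

module _ (q : ℕ) (q-prime : Prime q) (q%4≡3 : q % 4 ≡ 3) where

  instance
    q-nonZero : NonZero q
    q-nonZero = prime⇒nonZero q-prime

  2∤q^ : ∀ j → ¬ 2 ∣ q ^ j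
  2∤q^ j 2∣ = %4≡3⇒2∤ q%4≡3 (prime∣^ prime[2] q j 2∣)

  q∤2^ : ∀ i → ¬ q ∣ 2 ^ i
  q∤2^ i q∣ with irreducible[2] (prime∣^ q-prime 2 i q∣)
  ... | inj₁ refl = contradiction q%4≡3 λ ()
  ... | inj₂ refl = contradiction q%4≡3 λ ()

  Factored : ℕ → Set
  Factored n = ∃₂ λ i j → n ≡ 2 ^ i * q ^ j

  product-factored : ∀ ps → All Prime ps → (∀ p → Prime p → p ∣ product ps → p ≡ 2 ⊎ p ≡ q) →
                     Factored (product ps)
  product-factored [] [] _ = 0 , 0 , refl
  product-factored (p ∷ ps) (p-prime ∷ ps-prime) p∈S
    with p∈S p p-prime (m∣m*n (product ps))
       | product-factored ps ps-prime (λ r r-prime r∣ → p∈S r r-prime (∣n⇒∣m*n p r∣))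
  ... | inj₁ refl | i , j , eq = suc i , j , trans (cong (2 *_) eq) (sym (*-assoc 2 (2 ^ i) (q ^ j)))
  ... | inj₂ refl | i , j , eq = i , suc j , trans (cong (q *_) eq) (swap q (2 ^ i) (q ^ j))
    where
    swap : ∀ a b c → a * (b * c) ≡ b * (a * c)
    swap = solve-∀

  S-unit⇒factored : ∀ {n} → IsSUnit2q q n → Factored n
  S-unit⇒factored {n} (0<n , n∈S) = subst Factored (sym isFactorisation)
    (product-factored factors factorsPrime (subst (λ m → ∀ p → Prime p → p ∣ m → p ≡ 2 ⊎ p ≡ q) isFactorisation n∈S))
    where open PrimeFactorisation (factorise n {{>-nonZero 0<n}})

  factored-∤q : ∀ {n} → Factored n → ¬ q ∣ n → ∃ λ i → n ≡ 2 ^ i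
  factored-∤q (i , zero , eq) _ = i , trans eq (*-identityʳ (2 ^ i))
  factored-∤q (i , suc j , refl) q∤n = contradiction (∣n⇒∣m*n (2 ^ i) (m∣m*n (q ^ j))) q∤n

  factored-even : ∀ {n} → Factored n → 2 ∣ n → ∃₂ λ i j → n ≡ 2 ^ suc i * q ^ j
  factored-even (zero , j , refl) 2∣n = contradiction (subst (2 ∣_) (*-identityˡ (q ^ j)) 2∣n) (2∤q^ j)
  factored-even (suc i , j , eq) _ = i , j , eq

  factored-even-∤4 : ∀ {n} → Factored n → 2 ∣ n → ¬ 4 ∣ n → ∃ λ j → n ≡ 2 * q ^ j
  factored-even-∤4 f 2∣n 4∤n with factored-even f 2∣n
  ... | zero , j , eq = j , eq
  ... | suc i , j , refl = contradiction (∣m⇒∣m*n (q ^ j) (^-monoʳ-∣ 2 {2} {suc (suc i)} (s≤s (s≤s z≤n)))) 4∤n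

  2<⊛ : ∀ {x y} → 0 < x → 0 < y → x ≢ y → 2 < x ⊛ y
  2<⊛ {suc zero} {suc zero} _ _ x≢y = contradiction refl x≢y
  2<⊛ {suc zero} {suc (suc y)} _ _ _ = s≤s (s≤s (m≤n+m 1 (y + 0)))
  2<⊛ {suc (suc x)} {suc y} _ _ _ = ≤-trans (s≤s (s≤s (s≤s z≤n))) (≤-reflexive (identity x y))
    where
    identity : ∀ x y → 3 + (x * y + x + y + y) ≡ (2 + x) * (1 + y) + 1
    identity = solve-∀

  -- A label prime to `q` is a power of 2; it exceeds 2 because `x` and `y` are distinct, so 4
  -- divides it. This is the disjointness of the two edge sets.
  4∤⇒¬q∤ : ∀ {x y} → 0 < x → 0 < y → x ≢ y → Factored (x ⊛ y) → ¬ 4 ∣ x ⊛ y → ¬ ¬ q ∣ x ⊛ y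
  4∤⇒¬q∤ 0<x 0<y x≢y f 4∤ q∤ with factored-∤q f q∤ | 2<⊛ 0<x 0<y x≢y
  ... | 0 , eq | 2< = contradiction (subst (2 <_) eq 2<) λ { (s≤s ()) }
  ... | 1 , eq | 2< = contradiction (subst (2 <_) eq 2<) (<-irrefl refl)
  ... | suc (suc i) , eq | _ = 4∤ (subst (4 ∣_) (sym eq) (^-monoʳ-∣ 2 {2} {suc (suc i)} (s≤s (s≤s z≤n))))

  -- The matched configuration whose largest vertex is `w`.

  module Extremal
    {x y z w α β γ δ ε ζ κ ν : ℕ}
    (0<x : 0 < x) (0<y : 0 < y) (0<z : 0 < z)
    (x≢y : x ≢ y) (x≢z : x ≢ z)
    (x<w : x < w) (y<w : y < w) (z<w : z < w)
    (xz≡ : x ⊛ z ≡ 2 ^ α) (yw≡ : y ⊛ w ≡ 2 ^ δ)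
    (xy≡ : x ⊛ y ≡ 2 * q ^ β) (zw≡ : z ⊛ w ≡ 2 * q ^ γ)
    -- These two edges lie in neither matching, so both primes may occur. The exponents of 2 are
    -- successors because the labels are even.
    (xw≡ : x ⊛ w ≡ 2 ^ suc ε * q ^ κ) (yz≡ : y ⊛ z ≡ 2 ^ suc ζ * q ^ ν)
    where

    2^∣xz : ∀ {i} → i ≤ α → 2 ^ i ∣ x ⊛ z
    2^∣xz {i} i≤ = subst (2 ^ i ∣_) (sym xz≡) (^-monoʳ-∣ 2 i≤)

    2^∣yw : ∀ {i} → i ≤ δ → 2 ^ i ∣ y ⊛ w
    2^∣yw {i} i≤ = subst (2 ^ i ∣_) (sym yw≡) (^-monoʳ-∣ 2 i≤)

    2^∣xw : ∀ {i} → i ≤ suc ε → 2 ^ i ∣ x ⊛ w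
    2^∣xw {i} i≤ = subst (2 ^ i ∣_) (sym xw≡) (∣m⇒∣m*n (q ^ κ) (^-monoʳ-∣ 2 i≤))

    2^∣yz : ∀ {i} → i ≤ suc ζ → 2 ^ i ∣ y ⊛ z
    2^∣yz {i} i≤ = subst (2 ^ i ∣_) (sym yz≡) (∣m⇒∣m*n (q ^ ν) (^-monoʳ-∣ 2 i≤))

    q^∣xy : ∀ {i} → i ≤ β → q ^ i ∣ x ⊛ y
    q^∣xy {i} i≤ = subst (q ^ i ∣_) (sym xy≡) (∣n⇒∣m*n 2 (^-monoʳ-∣ q i≤))

    q^∣zw : ∀ {i} → i ≤ γ → q ^ i ∣ z ⊛ w
    q^∣zw {i} i≤ = subst (q ^ i ∣_) (sym zw≡) (∣n⇒∣m*n 2 (^-monoʳ-∣ q i≤))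

    q^∣xw : ∀ {i} → i ≤ κ → q ^ i ∣ x ⊛ w
    q^∣xw {i} i≤ = subst (q ^ i ∣_) (sym xw≡) (∣n⇒∣m*n (2 ^ suc ε) (^-monoʳ-∣ q i≤))

    q^∣yz : ∀ {i} → i ≤ ν → q ^ i ∣ y ⊛ z
    q^∣yz {i} i≤ = subst (q ^ i ∣_) (sym yz≡) (∣n⇒∣m*n (2 ^ suc ζ) (^-monoʳ-∣ q i≤))

    2*q^∣2^*q^ : ∀ e {i j} → i ≤ j → 2 * q ^ i ∣ 2 ^ suc e * q ^ j
    2*q^∣2^*q^ e i≤j = *-pres-∣ (m∣m*n {2} (2 ^ e)) (^-monoʳ-∣ q i≤j)

    2^∣2^*q^⇒≤ : ∀ i e j {n} → n ≡ 2 ^ e * q ^ j → 2 ^ i ∣ n → i ≤ e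
    2^∣2^*q^⇒≤ i e j refl = ^∣^*⇒≤ 2 i e (2∤q^ j)

    q^∣2^*q^⇒≤ : ∀ i {n} e {j} → n ≡ 2 ^ e * q ^ j → q ^ i ∣ n → i ≤ j
    q^∣2^*q^⇒≤ i e {j} refl d = ^∣^*⇒≤ q i j (q∤2^ e) (subst (q ^ i ∣_) (*-comm (2 ^ e) (q ^ j)) d)

    -- Otherwise the power of 2 that makes up `y ⊛ w` would divide `x ⊛ w`. For `κ<γ` the extra
    -- factor 2 in `z ⊛ w` is absorbed by the even label `x ⊛ w`.
    1+ε<δ : suc ε < δ
    1+ε<δ = ≰⇒> λ δ≤ → ∤-⊛-max 0<y (≢-sym x≢y) (<⇒≤ y<w) (<⇒≤ x<w)
      (subst (_∣ x ⊛ w) (sym yw≡) (2^∣xw δ≤))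

    κ<γ : κ < γ
    κ<γ = ≰⇒> λ γ≤ → ∤-⊛-max 0<z (≢-sym x≢z) (<⇒≤ z<w) (<⇒≤ x<w)
      (subst₂ _∣_ (sym zw≡) (sym xw≡) (2*q^∣2^*q^ ε γ≤))

    2^∣x-y : 2 ^ suc ε ∣ ∣ x - y ∣
    2^∣x-y = ∣⊛⇒∣∣-∣ w x y (∣⊛-comm x w (2^∣xw ≤-refl)) (∣⊛-comm y w (2^∣yw (<⇒≤ 1+ε<δ)))

    q^∣x-z : q ^ κ ∣ ∣ x - z ∣
    q^∣x-z = ∣⊛⇒∣∣-∣ w x z (∣⊛-comm x w (q^∣xw ≤-refl)) (∣⊛-comm z w (q^∣zw (<⇒≤ κ<γ)))

    -- The 2-part of `x ⊛ w` also divides `y ⊛ w`, and its `q`-part also divides `z ⊛ w`; cancelling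
    -- `w` leaves one difference for each part.
    xw≤ : x ⊛ w ≤ ∣ x - y ∣ * ∣ x - z ∣
    xw≤ = ∣⇒≤ {{m*n≢0 _ _ {{∣-∣≢0 x≢y}} {{∣-∣≢0 x≢z}}}}
      (subst (_∣ ∣ x - y ∣ * ∣ x - z ∣) (sym xw≡) (*-pres-∣ 2^∣x-y q^∣x-z))

    ⊛≰* : ∀ a b {c d} → c ≤ a → d ≤ b → ¬ a ⊛ b ≤ c * d
    ⊛≰* a b c≤a d≤b ≤cd = <⇒≱ (m<m+n (a * b) z<s) (≤-trans ≤cd (*-mono-≤ c≤a d≤b))

    -- If `y < x`, the two differences in `xw≤` are at most `x` and `w`, and their product is too
    -- small.
    x<y : x < y
    x<y = ≤∧≢⇒< (≮⇒≥ λ y<x → ⊛≰* x w (∣-∣≤ ≤-refl (<⇒≤ y<x)) (∣-∣≤ (<⇒≤ x<w) (<⇒≤ z<w)) xw≤) x≢y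

    x<z : x < z
    x<z = ≤∧≢⇒< (≮⇒≥ λ z<x → ⊛≰* x w (∣-∣≤ ≤-refl (<⇒≤ z<x)) (∣-∣≤ (<⇒≤ x<w) (<⇒≤ y<w))
      (subst (x ⊛ w ≤_) (*-comm ∣ x - y ∣ ∣ x - z ∣) xw≤)) x≢z

    1+ζ<δ : suc ζ < δ
    1+ζ<δ = ≰⇒> λ δ≤ → ∤-⊛-< y z<w 0<y (subst (_∣ y ⊛ z) (sym yw≡) (2^∣yz δ≤))

    ν<γ : ν < γ
    ν<γ = ≰⇒> λ γ≤ → ∤-⊛-< z y<w 0<z
      (∣⊛-comm y z (subst₂ _∣_ (sym zw≡) (sym yz≡) (2*q^∣2^*q^ ζ γ≤)))

    yz≰ : ∀ {c d} → c ≤ y → d ≤ z → ¬ y ⊛ z ≤ c * d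
    yz≰ = ⊛≰* y z

    ∣x-y∣≤y : ∣ x - y ∣ ≤ y
    ∣x-y∣≤y = ∣-∣≤ (<⇒≤ x<y) ≤-refl

    ∣x-z∣≤z : ∣ x - z ∣ ≤ z
    ∣x-z∣≤z = ∣-∣≤ (<⇒≤ x<z) ≤-refl

    -- Both `x ⊛ z` and `x ⊛ y` divide `y ⊛ z`. The first then divides `∣ x - y ∣`, giving `z < y`;
    -- the second divides `∣ x - z ∣`, giving `y < z`.
    both-small : α ≤ suc ζ → β ≤ ν → ⊥
    both-small α≤ β≤ = <-asym
      (≤-trans (⊛⇒< x z 0<x) (≤-trans (∣⇒≤ {{∣-∣≢0 x≢y}} xz∣x-y) ∣x-y∣≤y))
      (≤-trans (⊛⇒< x y 0<x) (≤-trans (∣⇒≤ {{∣-∣≢0 x≢z}} xy∣x-z) ∣x-z∣≤z))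
      where
      ⊛⇒< : ∀ a b → 0 < a → b < a ⊛ b
      ⊛⇒< a b 0<a = subst (b <_) (+-comm 1 (a * b)) (s≤s (m≤n*m b a {{>-nonZero 0<a}}))
      xz∣x-y : x ⊛ z ∣ ∣ x - y ∣
      xz∣x-y = ∣⊛⇒∣∣-∣ z x y (∣⊛-comm x z ∣-refl)
        (∣⊛-comm y z (subst (_∣ y ⊛ z) (sym xz≡) (2^∣yz α≤)))
      xy∣x-z : x ⊛ y ∣ ∣ x - z ∣
      xy∣x-z = ∣⊛⇒∣∣-∣ y x z (∣⊛-comm x y ∣-refl) (subst₂ _∣_ (sym xy≡) (sym yz≡) (2*q^∣2^*q^ ζ β≤))

    -- The 2-part of `y ⊛ z` divides `∣ x - y ∣` and its `q`-part divides `∣ x - z ∣`, but these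
    -- differences are at most `y` and `z`.
    both-large : suc ζ < α → ν < β → ⊥
    both-large <α <β = yz≰ ∣x-y∣≤y ∣x-z∣≤z
      (∣⇒≤ {{m*n≢0 _ _ {{∣-∣≢0 x≢y}} {{∣-∣≢0 x≢z}}}}
        (subst (_∣ ∣ x - y ∣ * ∣ x - z ∣) (sym yz≡) (*-pres-∣
          (∣⊛⇒∣∣-∣ z x y (∣⊛-comm x z (2^∣xz (<⇒≤ <α))) (∣⊛-comm y z (2^∣yz ≤-refl)))
          (∣⊛⇒∣∣-∣ y x z (∣⊛-comm x y (q^∣xy (<⇒≤ <β))) (q^∣yz ≤-refl)))))

    -- Here `x ⊛ z` divides `y ⊛ z`. Comparing exponents on four-cycles shows that `x ⊛ w` is
    -- `x ⊛ z * q ^ κ`, so that `no-chain` applies with `z` as `p`, `y` as `o` and `q ^ κ` as `Q`.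
    case-y-large : α ≤ suc ζ → ν < β → ⊥
    case-y-large α≤ ν<β = no-chain {u = 2 ^ (suc ζ ∸ α)} 0<x x<z z<w x<y
      (trans xw≡ (cong₂ _*_ (trans (cong (2 ^_) (sym α≡)) (sym xz≡)) refl))
      (trans (⊛-comm z y) (trans yz≡ yz≡′)) q^∣x-z
      (subst (_∣ ∣ z - w ∣) 2^≡
        (∣⊛⇒∣∣-∣ y z w (2^∣yz ≤-refl) (2^∣yw (<⇒≤ 1+ζ<δ))))
      where
      q^∣yz-from : ∀ {i} → i ≤ β → i ≤ κ → i ≤ γ → i ≤ ν
      q^∣yz-from {i} i≤β i≤κ i≤γ = q^∣2^*q^⇒≤ i (suc ζ) yz≡
        (∣⊛-cycle y x w z (∣⊛-comm x y (q^∣xy i≤β)) (q^∣xw i≤κ) (∣⊛-comm z w (q^∣zw i≤γ)))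

      κ<β : κ < β
      κ<β = ≰⇒> λ β≤κ → <⇒≱ ν<β (q^∣yz-from ≤-refl β≤κ (≤-trans β≤κ (<⇒≤ κ<γ)))

      -- On the cycle `x`, `y`, `z`, `w` the exponents of `q` are `β`, `ν`, `γ`, `κ`; since `ν` is
      -- below `β` and `γ`, the least one is shared by `ν` and `κ`.
      κ≡ν : κ ≡ ν
      κ≡ν = ≤-antisym (q^∣yz-from (<⇒≤ κ<β) ≤-refl (<⇒≤ κ<γ))
        (q^∣2^*q^⇒≤ ν (suc ε) xw≡ (∣⊛-cycle x y z w (q^∣xy (<⇒≤ ν<β)) (q^∣yz ≤-refl) (q^∣zw (<⇒≤ ν<γ))))

      -- Otherwise `2 ^ suc ζ` is at most `∣ x - y ∣` and `q ^ ν` at most `∣ x - z ∣`, so `y ⊛ z`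
      -- would not exceed `y * z`.
      ε<ζ : ε < ζ
      ε<ζ = ≰⇒> λ ζ≤ε → yz≰ {2 ^ suc ζ} {q ^ ν}
        (≤-trans (^-monoʳ-≤ 2 (s≤s ζ≤ε)) (≤-trans (∣⇒≤ {{∣-∣≢0 x≢y}} 2^∣x-y) ∣x-y∣≤y))
        (≤-trans (∣⇒≤ {{∣-∣≢0 x≢z}} (subst (λ t → q ^ t ∣ ∣ x - z ∣) κ≡ν q^∣x-z)) ∣x-z∣≤z)
        (≤-reflexive yz≡)

      -- On the cycle `x`, `z`, `y`, `w` the exponents of 2 are `α`, `suc ζ`, `δ`, `suc ε`, and the
      -- middle two exceed the last.
      α≡ : α ≡ suc ε
      α≡ = ≤-antisym
        (2^∣2^*q^⇒≤ α (suc ε) κ xw≡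
          (∣⊛-cycle x z y w (2^∣xz ≤-refl) (∣⊛-comm y z (2^∣yz α≤)) (2^∣yw (≤-trans α≤ (<⇒≤ 1+ζ<δ)))))
        (2^∣2^*q^⇒≤ (suc ε) α 0 (trans xz≡ (sym (*-identityʳ (2 ^ α))))
          (∣⊛-cycle x w y z (2^∣xw ≤-refl) (∣⊛-comm y w (2^∣yw (<⇒≤ 1+ε<δ))) (2^∣yz (s≤s (<⇒≤ ε<ζ)))))

      2^≡ : 2 ^ suc ζ ≡ x ⊛ z * 2 ^ (suc ζ ∸ α)
      2^≡ = trans (cong (2 ^_) (sym (m+[n∸m]≡n α≤)))
        (trans (^-distribˡ-+-* 2 α (suc ζ ∸ α)) (cong (_* 2 ^ (suc ζ ∸ α)) (sym xz≡)))

      yz≡′ : 2 ^ suc ζ * q ^ ν ≡ x ⊛ z * (q ^ κ * 2 ^ (suc ζ ∸ α))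
      yz≡′ = trans (cong₂ (λ s t → s * q ^ t) 2^≡ (sym κ≡ν)) (swap (x ⊛ z) (2 ^ (suc ζ ∸ α)) (q ^ κ))
        where
        swap : ∀ a b c → a * b * c ≡ a * (c * b)
        swap = solve-∀

    -- Now `x ⊛ y` divides `y ⊛ z`. The same comparisons give `ζ ≡ ε` and `β ≤ κ`, but equality of
    -- `β` and `κ` is not forced, so both possibilities are refuted.
    case-z-large : suc ζ < α → β ≤ ν → ⊥
    case-z-large ζ<α β≤ν = [ β≮κ , β≢κ ]′ (m≤n⇒m<n∨m≡n β≤κ)
      where
      2^∣yz-from : ∀ {i} → i ≤ α → i ≤ suc ε → i ≤ suc ζ
      2^∣yz-from {i} i≤α i≤ε = 2^∣2^*q^⇒≤ i (suc ζ) ν yz≡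
        (∣⊛-cycle y w x z (2^∣yw (≤-trans i≤ε (<⇒≤ 1+ε<δ))) (∣⊛-comm x w (2^∣xw i≤ε)) (2^∣xz i≤α))

      ε<α : suc ε < α
      ε<α = ≰⇒> λ α≤ε → <⇒≱ ζ<α (2^∣yz-from ≤-refl α≤ε)

      ζ≡ε : ζ ≡ ε
      ζ≡ε = suc-injective (≤-antisym
        (2^∣2^*q^⇒≤ (suc ζ) (suc ε) κ xw≡
          (∣⊛-cycle x z y w (2^∣xz (<⇒≤ ζ<α)) (∣⊛-comm y z (2^∣yz ≤-refl)) (2^∣yw (<⇒≤ 1+ζ<δ))))
        (2^∣yz-from (<⇒≤ ε<α) ≤-refl))

      β≤κ : β ≤ κ
      β≤κ = q^∣2^*q^⇒≤ β (suc ε) xw≡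
        (∣⊛-cycle x y z w (q^∣xy ≤-refl) (q^∣yz β≤ν) (q^∣zw (≤-trans β≤ν (<⇒≤ ν<γ))))

      Q∣x-y : 2 ^ ε ∣ ∣ x - y ∣
      Q∣x-y = ∣-trans (n∣m*n 2) 2^∣x-y

      yz≡′ : ∀ {u} → q ^ ν ≡ q ^ β * u → y ⊛ z ≡ x ⊛ y * (2 ^ ε * u)
      yz≡′ {u} q^ν≡ = trans yz≡ (trans (cong₂ (λ s t → 2 ^ suc s * t) ζ≡ε q^ν≡)
        (trans (rearrange (2 ^ ε) (q ^ β) u) (cong (_* (2 ^ ε * u)) (sym xy≡))))
        where
        rearrange : ∀ a b c → 2 * a * (b * c) ≡ 2 * b * (a * c)
        rearrange = solve-∀

      -- One factor 2 of `x ⊛ w` is used up by `x ⊛ y`, so the cofactor is `2 ^ ε`. It serves as `Q`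
      -- in `no-chain`, with `y` as `p` and `z` as `o`.
      β≢κ : β ≢ κ
      β≢κ β≡κ = no-chain {u = q ^ (ν ∸ β)} 0<x x<y y<w x<z
        (trans xw≡ (trans (cong (λ t → 2 ^ suc ε * q ^ t) (sym β≡κ))
          (trans (rearrange (2 ^ ε) (q ^ β)) (cong (_* 2 ^ ε) (sym xy≡)))))
        (yz≡′ q^ν≡) Q∣x-y
        (subst (_∣ ∣ y - w ∣) (trans (cong (2 *_) q^ν≡)
            (trans (sym (*-assoc 2 (q ^ β) _)) (cong (_* q ^ (ν ∸ β)) (sym xy≡))))
          (∣⊛⇒∣∣-∣ z y w
            (∣⊛-comm y z (subst (2 * q ^ ν ∣_) (sym yz≡) (2*q^∣2^*q^ ζ {ν} ≤-refl)))
            (subst (2 * q ^ ν ∣_) (sym zw≡) (*-monoʳ-∣ 2 (^-monoʳ-∣ q (<⇒≤ ν<γ))))))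
        where
        rearrange : ∀ a b → 2 * a * b ≡ 2 * b * a
        rearrange = solve-∀
        q^ν≡ : q ^ ν ≡ q ^ β * q ^ (ν ∸ β)
        q^ν≡ = trans (cong (q ^_) (sym (m+[n∸m]≡n β≤ν))) (^-distribˡ-+-* q β (ν ∸ β))

      -- In this case `β` equals `ν`, and `y ⊛ z` is `x ⊛ y * 2 ^ ε`. As `z` is `x` plus a positive
      -- multiple of `x ⊛ y`, the cofactor `2 ^ ε` exceeds `y`, yet it divides `∣ x - y ∣`.
      β≮κ : ¬ β < κ
      β≮κ β<κ with ∣∣-∣⇒≡+ x<z (∣⊛⇒∣∣-∣ y x z (∣⊛-comm x y ∣-refl) xy∣yz)
        where
        xy∣yz : x ⊛ y ∣ y ⊛ z
        xy∣yz = subst₂ _∣_ (sym xy≡) (sym yz≡) (2*q^∣2^*q^ ζ β≤ν)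
      ... | t , z≡ = <⇒≱ y<Q (≤-trans (∣⇒≤ {{∣-∣≢0 x≢y}} Q∣x-y) ∣x-y∣≤y)
        where
        -- Otherwise `β` would be the least exponent of `q` on the cycle `x`, `w`, `z`, `y` and
        -- attained only once.
        ν≤β : ν ≤ β
        ν≤β = ≮⇒≥ λ β<ν → <-irrefl refl (q^∣2^*q^⇒≤ (suc β) 1 xy≡
          (∣⊛-cycle x w z y (q^∣xw β<κ) (∣⊛-comm z w (q^∣zw (≤-trans β<ν (<⇒≤ ν<γ)))) (∣⊛-comm y z (q^∣yz β<ν))))
        Q≡ : 2 ^ ε * 1 ≡ 1 + y * suc t
        Q≡ = *-cancelˡ-≡ _ _ (x ⊛ y) {{⊛-nonZero x y}} (trans
          (sym (yz≡′ (trans (cong (q ^_) (≤-antisym ν≤β β≤ν)) (sym (*-identityʳ (q ^ β))))))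
          (trans (cong (y ⊛_) z≡) (⊛-factor-+ x y (suc t))))
        y<Q : y < 2 ^ ε
        y<Q = subst (y <_) (trans (sym Q≡) (*-identityʳ (2 ^ ε))) (s≤s (m≤m*n y (suc t)))

    impossible : ⊥
    impossible with ≤-<-connex α (suc ζ) | ≤-<-connex β ν
    ... | inj₁ α≤ | inj₁ β≤ = both-small α≤ β≤
    ... | inj₁ α≤ | inj₂ <β = case-y-large α≤ <β
    ... | inj₂ <α | inj₁ β≤ = case-z-large <α β≤
    ... | inj₂ <α | inj₂ <β = both-large <α <β

  -- Relabelling, and reduction to the extremal configuration.

  record Quadruple (x y z w : ℕ) : Set where
    constructor quadruple
    field
      0<x : 0 < x
      0<y : 0 < y
      0<z : 0 < z
      0<w : 0 < w
      x≢y : x ≢ y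
      x≢z : x ≢ z
      x≢w : x ≢ w
      y≢z : y ≢ z
      y≢w : y ≢ w
      z≢w : z ≢ w
      xy  : Factored (x ⊛ y)
      xz  : Factored (x ⊛ z)
      xw  : Factored (x ⊛ w)
      yz  : Factored (y ⊛ z)
      yw  : Factored (y ⊛ w)
      zw  : Factored (z ⊛ w)

  factored-comm : ∀ x y → Factored (x ⊛ y) → Factored (y ⊛ x)
  factored-comm x y = subst Factored (⊛-comm x y)

  ∤⊛-comm : ∀ {n} x y → ¬ n ∣ x ⊛ y → ¬ n ∣ y ⊛ x
  ∤⊛-comm x y n∤ n∣ = n∤ (∣⊛-comm y x n∣)

  -- Together with `swap-zw` this permutes the three perfect matchings arbitrarily while fixing `x`.
  swap-yz : ∀ {x y z w} → Quadruple x y z w → Quadruple x z y w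
  swap-yz {x} {y} {z} {w} Q = quadruple 0<x 0<z 0<y 0<w x≢z x≢y x≢w (≢-sym y≢z) z≢w y≢w
    xz xy xw (factored-comm y z yz) zw yw
    where open Quadruple Q

  swap-zw : ∀ {x y z w} → Quadruple x y z w → Quadruple x y w z
  swap-zw {x} {y} {z} {w} Q = quadruple 0<x 0<y 0<w 0<z x≢y x≢w x≢z y≢w y≢z (≢-sym z≢w)
    xy xw xz yw yz (factored-comm z w zw)
    where open Quadruple Q

  swap-pairs : ∀ {x y z w} → Quadruple x y z w → Quadruple z w x y
  swap-pairs {x} {y} {z} {w} Q = quadruple 0<z 0<w 0<x 0<y z≢w (≢-sym x≢z) (≢-sym y≢z) (≢-sym x≢w) (≢-sym y≢w) x≢y
    zw (factored-comm x z xz) (factored-comm y z yz) (factored-comm x w xw) (factored-comm y w yw) xy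
    where open Quadruple Q

  record Matched (x y z w : ℕ) : Set where
    constructor matched
    field
      4∤xy : ¬ 4 ∣ x ⊛ y
      4∤zw : ¬ 4 ∣ z ⊛ w
      q∤xz : ¬ q ∣ x ⊛ z
      q∤yw : ¬ q ∣ y ⊛ w

  matched-max : ∀ {x y z w} → Quadruple x y z w → Matched x y z w → x ≤ w → y ≤ w → z ≤ w → ⊥
  matched-max {x} {y} {z} {w} Q (matched 4∤xy 4∤zw q∤xz q∤yw) x≤w y≤w z≤w
    with factored-∤q (Quadruple.xz Q) q∤xz | factored-∤q (Quadruple.yw Q) q∤yw
  ... | α , xz≡ | δ , yw≡ = conclude
    (factored-even-∤4 xy (2∣⊛ x y x-odd y-odd) 4∤xy) (factored-even-∤4 zw (2∣⊛ z w z-odd w-odd) 4∤zw)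
    (factored-even xw (2∣⊛ x w x-odd w-odd)) (factored-even yz (2∣⊛ y z y-odd z-odd))
    where
    open Quadruple Q
    >2⇒even : ∀ {n} i → 2 < n → n ≡ 2 ^ i → 2 ∣ n
    >2⇒even zero (s≤s ()) refl
    >2⇒even (suc i) _ refl = m∣m*n (2 ^ i)
    -- The powers of 2 on `x z` and `y w` exceed 2 and hence are even. These two edges cover all
    -- vertices, so all four numbers are odd and every label is even.
    2∣xz = >2⇒even α (2<⊛ 0<x 0<z x≢z) xz≡
    2∣yw = >2⇒even δ (2<⊛ 0<y 0<w y≢w) yw≡
    x-odd = ⊛-odd x z 2∣xz
    z-odd = ⊛-odd z x (∣⊛-comm x z 2∣xz)
    y-odd = ⊛-odd y w 2∣yw
    w-odd = ⊛-odd w y (∣⊛-comm y w 2∣yw)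
    conclude : (∃ λ j → x ⊛ y ≡ 2 * q ^ j) → (∃ λ j → z ⊛ w ≡ 2 * q ^ j) →
               (∃₂ λ i j → x ⊛ w ≡ 2 ^ suc i * q ^ j) → (∃₂ λ i j → y ⊛ z ≡ 2 ^ suc i * q ^ j) → ⊥
    conclude (β , xy≡) (γ , zw≡) (ε , κ , xw≡) (ζ , ν , yz≡) =
      Extremal.impossible {α = α} {β} {γ} {δ} {ε} {ζ} {κ} {ν} 0<x 0<y 0<z x≢y x≢z
        (≤∧≢⇒< x≤w x≢w) (≤∧≢⇒< y≤w y≢w) (≤∧≢⇒< z≤w z≢w) xz≡ yw≡ xy≡ zw≡ xw≡ yz≡

  flip-pairs : ∀ {x y z w} → Quadruple x y z w → Quadruple y x w z
  flip-pairs Q = swap-pairs (swap-zw (swap-pairs (swap-zw Q)))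

  matched-swap-pairs : ∀ {x y z w} → Matched x y z w → Matched z w x y
  matched-swap-pairs {x} {y} {z} {w} (matched 4∤xy 4∤zw q∤xz q∤yw) =
    matched 4∤zw 4∤xy (∤⊛-comm x z q∤xz) (∤⊛-comm y w q∤yw)

  matched-flip-pairs : ∀ {x y z w} → Matched x y z w → Matched y x w z
  matched-flip-pairs {x} {y} {z} {w} (matched 4∤xy 4∤zw q∤xz q∤yw) =
    matched (∤⊛-comm x y 4∤xy) (∤⊛-comm z w 4∤zw) q∤yw q∤xz

  -- `swap-pairs` and `flip-pairs` preserve `Matched` and can bring any vertex to the last place, so
  -- the largest one may be put there.
  no-matched : ∀ {x y z w} → Quadruple x y z w → ¬ Matched x y z w
  no-matched {z = z} {w} Q M =
    [ ordered Q M , ordered (flip-pairs Q) (matched-flip-pairs M) ]′ (≤-total z w)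
    where
    above-first-pair : ∀ {x y z w} → Quadruple x y z w → Matched x y z w → x ≤ w → y ≤ w → ⊥
    above-first-pair {z = z} {w} Q M x≤w y≤w with ≤-total z w
    ... | inj₁ z≤w = matched-max Q M x≤w y≤w z≤w
    ... | inj₂ w≤z = matched-max (flip-pairs Q) (matched-flip-pairs M)
                       (≤-trans y≤w w≤z) (≤-trans x≤w w≤z) w≤z

    ordered : ∀ {x y z w} → Quadruple x y z w → Matched x y z w → z ≤ w → ⊥
    ordered {x} {y} {z} {w} Q M z≤w with ≤-total x w | ≤-total y w
    ... | inj₁ x≤w | inj₁ y≤w = above-first-pair Q M x≤w y≤w
    ... | _ | inj₂ w≤y =
      above-first-pair (swap-pairs Q) (matched-swap-pairs M) (≤-trans z≤w w≤y) w≤y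
    ... | inj₂ w≤x | _ =
      above-first-pair (flip-pairs (swap-pairs Q)) (matched-flip-pairs (matched-swap-pairs M))
        w≤x (≤-trans z≤w w≤x)

  no-quadruple : ∀ {a b c d} → ¬ Quadruple a b c d
  no-quadruple {a} {b} {c} {d} Q = conclude
    (hitting⇒matching (4-hits a b c) (4-hits a b d) (4-hits a c d) (4-hits b c d)
      -- A triangle of edges not divisible by 4 would be met by an edge not divisible by `q`,
      -- against the disjointness of the two sets.
      (disjoint (q-hits a b c) ab ac bc) (disjoint (q-hits a b d) ab ad bd)
      (disjoint (q-hits a c d) ac ad cd) (disjoint (q-hits b c d) bc bd cd))
    (hitting⇒matching (q-hits a b c) (q-hits a b d) (q-hits a c d) (q-hits b c d)
      (disjoint (4-hits a b c) (flip ab) (flip ac) (flip bc))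
      (disjoint (4-hits a b d) (flip ab) (flip ad) (flip bd))
      (disjoint (4-hits a c d) (flip ac) (flip ad) (flip cd))
      (disjoint (4-hits b c d) (flip bc) (flip bd) (flip cd)))
    where
    open Quadruple Q renaming
      (0<x to 0<a; 0<y to 0<b; 0<z to 0<c; 0<w to 0<d;
       x≢y to a≢b; x≢z to a≢c; x≢w to a≢d; y≢z to b≢c; y≢w to b≢d; z≢w to c≢d;
       xy to fab; xz to fac; xw to fad; yz to fbc; yw to fbd; zw to fcd)

    4-hits : ∀ x y z → ¬ 4 ∣ x ⊛ y ⊎ ¬ 4 ∣ x ⊛ z ⊎ ¬ 4 ∣ y ⊛ z
    4-hits x y z = one-missing 4 _ _ _ (no-4∣-triangle x y z)

    q-hits : ∀ x y z → ¬ q ∣ x ⊛ y ⊎ ¬ q ∣ x ⊛ z ⊎ ¬ q ∣ y ⊛ z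
    q-hits x y z = one-missing q _ _ _ (%4≡3⇒no-∣-triangle q%4≡3 x y z)

    ab = 4∤⇒¬q∤ 0<a 0<b a≢b fab
    ac = 4∤⇒¬q∤ 0<a 0<c a≢c fac
    ad = 4∤⇒¬q∤ 0<a 0<d a≢d fad
    bc = 4∤⇒¬q∤ 0<b 0<c b≢c fbc
    bd = 4∤⇒¬q∤ 0<b 0<d b≢d fbd
    cd = 4∤⇒¬q∤ 0<c 0<d c≢d fcd

    disjoint : {P₁ P₂ P₃ R₁ R₂ R₃ : Set} → R₁ ⊎ R₂ ⊎ R₃ →
               (P₁ → ¬ R₁) → (P₂ → ¬ R₂) → (P₃ → ¬ R₃) → ¬ (P₁ × P₂ × P₃)
    disjoint (inj₁ r) f _ _ (p , _ , _) = f p r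
    disjoint (inj₂ (inj₁ r)) _ f _ (_ , p , _) = f p r
    disjoint (inj₂ (inj₂ r)) _ _ f (_ , _ , p) = f p r

    Matching : ℕ → Set
    Matching n = (¬ n ∣ a ⊛ b × ¬ n ∣ c ⊛ d) ⊎ (¬ n ∣ a ⊛ c × ¬ n ∣ b ⊛ d) ⊎ (¬ n ∣ a ⊛ d × ¬ n ∣ b ⊛ c)

    -- Equal matchings contradict disjointness; each of the six ordered pairs of different ones is
    -- brought to the form `Matched` by relabelling.
    conclude : Matching 4 → ¬ Matching q
    conclude (inj₁ (4∤ab , _)) (inj₁ (q∤ab , _)) = ab 4∤ab q∤ab
    conclude (inj₁ (4∤ab , 4∤cd)) (inj₂ (inj₁ (q∤ac , q∤bd))) =
      no-matched Q (matched 4∤ab 4∤cd q∤ac q∤bd)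
    conclude (inj₁ (4∤ab , 4∤cd)) (inj₂ (inj₂ (q∤ad , q∤bc))) =
      no-matched (swap-zw Q) (matched 4∤ab (∤⊛-comm c d 4∤cd) q∤ad q∤bc)
    conclude (inj₂ (inj₁ (4∤ac , 4∤bd))) (inj₁ (q∤ab , q∤cd)) =
      no-matched (swap-yz Q) (matched 4∤ac 4∤bd q∤ab q∤cd)
    conclude (inj₂ (inj₁ (4∤ac , _))) (inj₂ (inj₁ (q∤ac , _))) = ac 4∤ac q∤ac
    conclude (inj₂ (inj₁ (4∤ac , 4∤bd))) (inj₂ (inj₂ (q∤ad , q∤bc))) =
      no-matched (swap-zw (swap-yz Q)) (matched 4∤ac (∤⊛-comm b d 4∤bd) q∤ad (∤⊛-comm b c q∤bc))
    conclude (inj₂ (inj₂ (4∤ad , 4∤bc))) (inj₁ (q∤ab , q∤cd)) =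
      no-matched (swap-yz (swap-zw Q)) (matched 4∤ad 4∤bc q∤ab (∤⊛-comm c d q∤cd))
    conclude (inj₂ (inj₂ (4∤ad , 4∤bc))) (inj₂ (inj₁ (q∤ac , q∤bd))) =
      no-matched (swap-zw (swap-yz (swap-zw Q))) (matched 4∤ad (∤⊛-comm b c 4∤bc) q∤ac (∤⊛-comm b d q∤bd))
    conclude (inj₂ (inj₂ (4∤ad , _))) (inj₂ (inj₂ (q∤ad , _))) = ad 4∤ad q∤ad

theorem1 : (q : ℕ) → Prime q → q % 4 ≡ 3 →
    (a b c d : ℕ) → ¬ IsSDiophantineQuadruple2q q a b c d
theorem1 q q-prime q%4≡3 a b c d
  ((0<a , 0<b , 0<c , 0<d) , (a≢b , a≢c , a≢d , b≢c , b≢d , c≢d) , (ab , ac , ad , bc , bd , cd)) =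
  no-quadruple q q-prime q%4≡3
    (quadruple 0<a 0<b 0<c 0<d a≢b a≢c a≢d b≢c b≢d c≢d
      (factored ab) (factored ac) (factored ad) (factored bc) (factored bd) (factored cd))
  where
  factored : ∀ {n} → IsSUnit2q q n → Factored q q-prime q%4≡3 n
  factored = S-unit⇒factored q q-prime q%4≡3
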